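{- Let $(X_n)$ be a sequence of finite sets and let $(\mathcal{F}_n)$ be a sequence of nontrivial upper sets $\mathcal{F}_n \subseteq 2^{X_n}$. Let $K>0$ be a constant such that $p_c(\mathcal{F}_n)\leq K q(\mathcal{F}_n)\log \ell(\mathcal{F}_n)$ for all $n$. If $\ell(\mathcal{F}_n)\to\infty$ and the Kahn-Kalai bounds provide nontrivial information for $(\mathcal{F}_n)$, then $\frac{1}{q(\mathcal{F}_n)}\to\infty$ and $\dim(\mathcal{F}_n)\to\infty$.
   Context: For a finite set $X$, an upper set is a subset $\mathcal{F}\subseteq 2^X$ such that $A\in\mathcal{F}$ and $A\subseteq B\subseteq X$ imply $B\in\mathcal{F}$; it is nontrivial if $\mathcal{F}\neq\emptyset$ and $\mathcal{F}\neq 2^X$. For $p\in[0,1]$ let $\mu_p(\mathcal{F})=\sum_{S\in\mathcal{F}}p^{|S|}(1-p)^{|X|-|S|}$; for nontrivial $\mathcal{F}$, the critical probability $p_c(\mathcal{F})$ is the unique $p\in[0,1]$ with $\mu_p(\mathcal{F})=\frac12$. For $S\subseteq X$ let $\langle S\rangle=\{T\subseteq X: S\subseteq T\}$, and for $\mathcal{G}\subseteq 2^X$ let $\langle\mathcal{G}\rangle=\bigcup_{S\in\mathcal{G}}\langle S\rangle$. A set $\mathcal{G}\subseteq 2^X$ is a cover of $\mathcal{F}$ if $\mathcal{F}\subseteq\langle\mathcal{G}\rangle$. $\mathcal{F}$ is $p$-small if it has a cover $\mathcal{G}$ with $\sum_{S\in\mathcal{G}}p^{|S|}\leq\frac12$.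 The expectation threshold $q(\mathcal{F})$ is the largest $p\in[0,1]$ for which $\mathcal{F}$ is $p$-small. The covering dimension is $\dim(\mathcal{F})=\min\{|\mathcal{G}|:\mathcal{G}\subseteq2^X,\ \mathcal{F}\subseteq\langle\mathcal{G}\rangle\neq2^X\}$. $\mathcal{F}_0$ denotes the set of (inclusion-)minimal elements of $\mathcal{F}$, $\ell_0(\mathcal{F})=\max\{|S|:S\in\mathcal{F}_0\}$ and $\ell(\mathcal{F})=\max\{\ell_0(\mathcal{F}),2\}$. $\log$ is the logarithm to base 2. The Kahn-Kalai bounds provide nontrivial information for $(\mathcal{F}_n)$ if there exists $N$ such that $Kq(\mathcal{F}_n)\log\ell(\mathcal{F}_n)<1$ for all $n\geq N$. -}

module Defs where

open import Data.Bool.Base using (Bool; T)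
open import Data.Bool.Properties using (T?)
open import Data.Empty using (⊥-elim)
open import Data.Fin.Subset as Subset using (Subset; inside; outside; _⊂_)
open import Data.Fin.Subset.Properties using (anySubset?; _⊂?_)
open import Data.Integer as ℤ using (+_; +[1+_])
import Data.Integer.Properties as ℤ
open import Data.Integer.Solver renaming (module +-*-Solver to ℤ-Solver)
open import Data.List.Base using (List; []; _∷_; _++_; map; filter; filterᵇ; length; foldr)
open import Data.List.Extrema.Nat using (max)
open import Data.Nat as ℕ using (ℕ; zero; suc; ⌊_/2⌋)
open import Data.Nat.Induction using (<-rec)
open import Data.Nat.Logarithm using (⌊log₂_⌋; ⌊log₂⌊n/2⌋⌋≡⌊log₂n⌋∸1; ⌊log₂⌋-mono-≤)
import Data.Nat.Properties as ℕ
open import Data.Product using (Σ-syntax; ∃; ∃-syntax; _×_; _,_; proj₁; proj₂)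
open import Data.Rational as ℚ using (ℚ; 0ℚ; 1ℚ; ½)
import Data.Rational.Properties as ℚ
open import Data.Rational.Solver using (module +-*-Solver)
import Data.Rational.Unnormalised as ℚᵘ
import Data.Rational.Unnormalised.Properties as ℚᵘ
open import Data.Sum.Base using (inj₁; inj₂)
open import Data.Vec.Base using ([]; _∷_)
open import Level using (0ℓ)
open import Relation.Binary.PropositionalEquality
  using (_≡_; refl; sym; trans; cong; cong₂; subst; subst₂)
open import Relation.Nullary using (¬_; yes; no; ¬?)
open import Relation.Nullary.Decidable using (_×-dec_)
open import Relation.Unary using (Pred; Decidable; _∈_; _⊆_; _≐_; ∅; U)

------------------------------------------------------------------------
-- Auxiliary facts about ℚ and ⌊log₂_⌋

private
  <-by : ∀ {p ε} → p ℚ.< ε → ℚ.- p ℚ.< ε → ℚ.∣ p ∣ ℚ.< ε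
  <-by {p} p<ε -p<ε with ℚ.∣p∣≡p∨∣p∣≡-p p
  ... | inj₁ e = subst (ℚ._< _) (sym e) p<ε
  ... | inj₂ e = subst (ℚ._< _) (sym e) -p<ε

  shift : ∀ {p q ε} → p ℚ.< q ℚ.+ ε → p ℚ.- q ℚ.< ε
  shift {p} {q} {ε} lt = subst (p ℚ.- q ℚ.<_)
    (solve 2 (λ q ε → q :+ ε :- q := ε) refl q ε) (ℚ.+-monoˡ-< (ℚ.- q) lt)
    where open +-*-Solver

  neg-sub : ∀ p q → ℚ.- (p ℚ.- q) ≡ q ℚ.- p
  neg-sub = solve 2 (λ p q → :- (p :- q) := q :- p) refl
    where open +-*-Solver

  dist< : ∀ {p q ε} → p ℚ.< q ℚ.+ ε → q ℚ.< p ℚ.+ ε → ℚ.∣ p ℚ.- q ∣ ℚ.< ε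
  dist< {p} {q} h₁ h₂ = <-by (shift h₁) (subst (ℚ._< _) (sym (neg-sub p q)) (shift h₂))

  pos* : ∀ {p q} → 0ℚ ℚ.< p → 0ℚ ℚ.< q → 0ℚ ℚ.< p ℚ.* q
  pos* {p} {q} 0<p 0<q =
    ℚ.positive⁻¹ (p ℚ.* q) {{ℚ.pos*pos⇒pos p {{ℚ.positive 0<p}} q {{ℚ.positive 0<q}}}}

  0<½ : 0ℚ ℚ.< ½
  0<½ = ℚ.positive⁻¹ ½

  half : ∀ ε → ½ ℚ.* ε ℚ.+ ½ ℚ.* ε ≡ ε
  half = solve 1 (λ ε → con ½ :* ε :+ con ½ :* ε := ε) refl
    where open +-*-Solver

  inv-pos : ∀ {p} (0<p : 0ℚ ℚ.< p) → 0ℚ ℚ.< (ℚ.1/ p) {{ℚ.>-nonZero 0<p}}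
  inv-pos {p} 0<p = ℚ.positive⁻¹ _ {{ℚ.1/pos⇒pos p {{ℚ.positive 0<p}}}}

  *-mono-≤ : ∀ {p q r s} → 0ℚ ℚ.≤ p → 0ℚ ℚ.≤ s → p ℚ.≤ q → r ℚ.≤ s → p ℚ.* r ℚ.≤ q ℚ.* s
  *-mono-≤ {p} {s = s} 0≤p 0≤s p≤q r≤s = ℚ.≤-trans
    (ℚ.*-monoˡ-≤-nonNeg p {{ℚ.nonNegative 0≤p}} r≤s)
    (ℚ.*-monoʳ-≤-nonNeg s {{ℚ.nonNegative 0≤s}} p≤q)

  -- For n ≥ 1:  2 ^ ⌊log₂ n⌋ ≤ n < 2 ^ (1 + ⌊log₂ n⌋).

  2*⌊n/2⌋≤n : ∀ n → 2 ℕ.* ⌊ n /2⌋ ℕ.≤ n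
  2*⌊n/2⌋≤n zero = ℕ.z≤n
  2*⌊n/2⌋≤n (suc zero) = ℕ.z≤n
  2*⌊n/2⌋≤n (suc (suc n)) = subst (ℕ._≤ suc (suc n)) (sym (ℕ.*-suc 2 ⌊ n /2⌋))
    (ℕ.s≤s (ℕ.s≤s (2*⌊n/2⌋≤n n)))

  n<2*[1+⌊n/2⌋] : ∀ n → n ℕ.< 2 ℕ.* suc ⌊ n /2⌋
  n<2*[1+⌊n/2⌋] zero = ℕ.s≤s ℕ.z≤n
  n<2*[1+⌊n/2⌋] (suc zero) = ℕ.s≤s (ℕ.s≤s ℕ.z≤n)
  n<2*[1+⌊n/2⌋] (suc (suc n)) = subst (suc (suc n) ℕ.<_) (sym (ℕ.*-suc 2 (suc ⌊ n /2⌋)))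
    (ℕ.s≤s (ℕ.s≤s (n<2*[1+⌊n/2⌋] n)))

  Sandwich : ℕ → Set
  Sandwich n = 1 ℕ.≤ n → (2 ℕ.^ ⌊log₂ n ⌋ ℕ.≤ n) × (n ℕ.< 2 ℕ.^ suc ⌊log₂ n ⌋)

  sandwich : ∀ n → Sandwich n
  sandwich = <-rec Sandwich step
    where
    step : ∀ n → (∀ {m} → m ℕ.< n → Sandwich m) → Sandwich n
    step 1 rec _ = ℕ.s≤s ℕ.z≤n , ℕ.s≤s (ℕ.s≤s ℕ.z≤n)
    step n@(suc (suc k)) rec _ = lower , upper
      where
      ih = rec {⌊ n /2⌋} (ℕ.⌊n/2⌋<n (suc k)) (ℕ.s≤s ℕ.z≤n)

      eq : ⌊log₂ n ⌋ ≡ suc ⌊log₂ ⌊ n /2⌋ ⌋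
      eq = trans (sym (ℕ.suc-pred ⌊log₂ n ⌋ {{ℕ.>-nonZero 1≤log}}))
                 (cong suc (sym (⌊log₂⌊n/2⌋⌋≡⌊log₂n⌋∸1 n)))
        where
        1≤log : 1 ℕ.≤ ⌊log₂ n ⌋
        1≤log = ⌊log₂⌋-mono-≤ {2} {n} (ℕ.s≤s (ℕ.s≤s ℕ.z≤n))

      lower : 2 ℕ.^ ⌊log₂ n ⌋ ℕ.≤ n
      lower = subst (λ l → 2 ℕ.^ l ℕ.≤ n) (sym eq)
        (ℕ.≤-trans (ℕ.*-monoʳ-≤ 2 (proj₁ ih)) (2*⌊n/2⌋≤n n))

      upper : n ℕ.< 2 ℕ.^ suc ⌊log₂ n ⌋
      upper = subst (λ l → n ℕ.< 2 ℕ.^ suc l) (sym eq)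
        (ℕ.≤-trans (n<2*[1+⌊n/2⌋] n) (ℕ.*-monoʳ-≤ 2 (proj₂ ih)))

  ^-cancel-< : ∀ a b → 2 ℕ.^ a ℕ.< 2 ℕ.^ b → a ℕ.< b
  ^-cancel-< a b lt with a ℕ.<? b
  ... | yes a<b = a<b
  ... | no  a≮b = ⊥-elim (ℕ.<⇒≱ lt (ℕ.^-monoʳ-≤ 2 (ℕ.≮⇒≥ a≮b)))

  log-cross : ∀ n M K → 1 ℕ.≤ n → 1 ℕ.≤ M →
              ⌊log₂ n ℕ.^ M ⌋ ℕ.* K ℕ.< suc ⌊log₂ n ℕ.^ K ⌋ ℕ.* M
  log-cross n M K 1≤n 1≤M = ^-cancel-< (a ℕ.* K) (suc b ℕ.* M) (begin-strict
    2 ℕ.^ (a ℕ.* K)        ≡⟨ sym (ℕ.^-*-assoc 2 a K) ⟩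
    (2 ℕ.^ a) ℕ.^ K        ≤⟨ ℕ.^-monoˡ-≤ K (proj₁ (sandwich (n ℕ.^ M) (1≤^ M))) ⟩
    (n ℕ.^ M) ℕ.^ K        ≡⟨ ℕ.^-*-assoc n M K ⟩
    n ℕ.^ (M ℕ.* K)        ≡⟨ cong (n ℕ.^_) (ℕ.*-comm M K) ⟩
    n ℕ.^ (K ℕ.* M)        ≡⟨ sym (ℕ.^-*-assoc n K M) ⟩
    (n ℕ.^ K) ℕ.^ M        <⟨ ℕ.^-monoˡ-< M {{ℕ.>-nonZero 1≤M}}
                                (proj₂ (sandwich (n ℕ.^ K) (1≤^ K))) ⟩
    (2 ℕ.^ suc b) ℕ.^ M    ≡⟨ ℕ.^-*-assoc 2 (suc b) M ⟩
    2 ℕ.^ (suc b ℕ.* M)    ∎)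
    where
    open ℕ.≤-Reasoning
    a = ⌊log₂ n ℕ.^ M ⌋
    b = ⌊log₂ n ℕ.^ K ⌋

    1≤^ : ∀ k → 1 ℕ.≤ n ℕ.^ k
    1≤^ k = ℕ.m^n>0 n {{ℕ.>-nonZero 1≤n}} k

  /-mono-< : ∀ a b m k → a ℕ.* suc k ℕ.< b ℕ.* suc m → + a ℚ./ suc m ℚ.< + b ℚ./ suc k
  /-mono-< a b m k lt = ℚ.toℚᵘ-cancel-< (ℚᵘ.<-respˡ-≃
    (ℚᵘ.≃-sym (ℚ.toℚᵘ-fromℚᵘ (ℚᵘ.mkℚᵘ (+ a) m)))
    (ℚᵘ.<-respʳ-≃ (ℚᵘ.≃-sym (ℚ.toℚᵘ-fromℚᵘ (ℚᵘ.mkℚᵘ (+ b) k)))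
      (ℚᵘ.*<* (subst₂ ℤ._<_ (ℤ.pos-* a (suc k)) (ℤ.pos-* b (suc m)) (ℤ.+<+ lt)))))

  /-suc : ∀ b k → + suc b ℚ./ suc k ≡ + b ℚ./ suc k ℚ.+ + 1 ℚ./ suc k
  /-suc b k = ℚ.toℚᵘ-injective (ℚᵘ.≃-trans (ℚ.toℚᵘ-fromℚᵘ (ℚᵘ.mkℚᵘ (+ suc b) k))
    (ℚᵘ.≃-sym (ℚᵘ.≃-trans (ℚ.toℚᵘ-homo-+ (+ b ℚ./ suc k) (+ 1 ℚ./ suc k))
      (ℚᵘ.≃-trans (ℚᵘ.+-cong (ℚ.toℚᵘ-fromℚᵘ (ℚᵘ.mkℚᵘ (+ b) k))
                             (ℚ.toℚᵘ-fromℚᵘ (ℚᵘ.mkℚᵘ (+ 1) k)))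
        (ℚᵘ.*≡* (eq (+ b) (+ suc k)))))))
    where
    eq : ∀ b k → (b ℤ.* k ℤ.+ + 1 ℤ.* k) ℤ.* k ≡ (+ 1 ℤ.+ b) ℤ.* (k ℤ.* k)
    eq = solve 2 (λ b k → (b :* k :+ con (+ 1) :* k) :* k
                          := (con (+ 1) :+ b) :* (k :* k)) refl
      where open ℤ-Solver

  archimedean : ∀ ε → 0ℚ ℚ.< ε → ∃[ N ] ∀ k → N ℕ.≤ k → + 1 ℚ./ suc k ℚ.< ε
  archimedean ε@(ℚ.mkℚ +[1+ a ] d _) _ = suc d , λ k d<k →
    subst (+ 1 ℚ./ suc k ℚ.<_) (ℚ.↥p/↧p≡p ε) (/-mono-< 1 (suc a) k d
      (ℕ.≤-trans (ℕ.s≤s (subst (ℕ._≤ k) (sym (ℕ.*-identityˡ (suc d))) d<k))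
                 (ℕ.m≤m+n (suc k) (a ℕ.* suc k))))
  archimedean (ℚ.mkℚ (+ zero) _ _) 0<ε with ℚ.positive 0<ε
  ... | ()
  archimedean (ℚ.mkℚ ℤ.-[1+ _ ] _ _) 0<ε with ℚ.positive 0<ε
  ... | ()

------------------------------------------------------------------------
-- Real numbers, as Cauchy sequences of rationals.  The equality of reals
-- is _≃_ below, not _≡_.

IsCauchy : (ℕ → ℚ) → Set
IsCauchy x = ∀ ε → 0ℚ ℚ.< ε →
  ∃[ N ] ∀ m n → N ℕ.≤ m → N ℕ.≤ n → ℚ.∣ x m ℚ.- x n ∣ ℚ.< ε

record ℝ : Set where
  constructor mkℝ
  field
    seq    : ℕ → ℚ
    cauchy : IsCauchy seq

open ℝ public

infix  4 _≃_ _≤_ _<_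
infixl 6 _+_ _-_
infixl 7 _*_
infix  8 -_
infixr 8 _^_

_≃_ : ℝ → ℝ → Set
x ≃ y = ∀ ε → 0ℚ ℚ.< ε → ∃[ N ] ∀ n → N ℕ.≤ n → ℚ.∣ seq x n ℚ.- seq y n ∣ ℚ.< ε

_≤_ : ℝ → ℝ → Set
x ≤ y = ∀ ε → 0ℚ ℚ.< ε → ∃[ N ] ∀ n → N ℕ.≤ n → seq x n ℚ.≤ seq y n ℚ.+ ε

_<_ : ℝ → ℝ → Set
x < y = ∃[ ε ] 0ℚ ℚ.< ε × ∃[ N ] ∀ n → N ℕ.≤ n → seq x n ℚ.+ ε ℚ.≤ seq y n

fromℚ : ℚ → ℝ
fromℚ p = mkℝ (λ _ → p) λ ε 0<ε →
  0 , λ _ _ _ _ → subst (λ d → ℚ.∣ d ∣ ℚ.< ε) (sym (ℚ.+-inverseʳ p)) 0<ε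

0ℝ 1ℝ ½ℝ : ℝ
0ℝ = fromℚ 0ℚ
1ℝ = fromℚ 1ℚ
½ℝ = fromℚ ½

_+_ : ℝ → ℝ → ℝ
x + y = mkℝ (λ n → seq x n ℚ.+ seq y n) c
  where
  c : IsCauchy (λ n → seq x n ℚ.+ seq y n)
  c ε 0<ε with cauchy x (½ ℚ.* ε) (pos* 0<½ 0<ε) | cauchy y (½ ℚ.* ε) (pos* 0<½ 0<ε)
  ... | N , hx | M , hy = N ℕ.⊔ M , λ m n Nm Nn →
    let a = seq x m ; b = seq x n ; c = seq y m ; d = seq y n in begin-strict
      ℚ.∣ (a ℚ.+ c) ℚ.- (b ℚ.+ d) ∣      ≡⟨ cong ℚ.∣_∣ (rearrange a b c d) ⟩
      ℚ.∣ (a ℚ.- b) ℚ.+ (c ℚ.- d) ∣      ≤⟨ ℚ.∣p+q∣≤∣p∣+∣q∣ (a ℚ.- b) (c ℚ.- d) ⟩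
      ℚ.∣ a ℚ.- b ∣ ℚ.+ ℚ.∣ c ℚ.- d ∣    <⟨ ℚ.+-mono-<
        (hx m n (ℕ.≤-trans (ℕ.m≤m⊔n N M) Nm) (ℕ.≤-trans (ℕ.m≤m⊔n N M) Nn))
        (hy m n (ℕ.≤-trans (ℕ.m≤n⊔m N M) Nm) (ℕ.≤-trans (ℕ.m≤n⊔m N M) Nn)) ⟩
      ½ ℚ.* ε ℚ.+ ½ ℚ.* ε                ≡⟨ half ε ⟩
      ε                                  ∎
    where
    open ℚ.≤-Reasoning
    rearrange : ∀ a b c d → (a ℚ.+ c) ℚ.- (b ℚ.+ d) ≡ (a ℚ.- b) ℚ.+ (c ℚ.- d)
    rearrange = solve 4 (λ a b c d → (a :+ c) :- (b :+ d) := (a :- b) :+ (c :- d)) refl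
      where open +-*-Solver

-_ : ℝ → ℝ
- x = mkℝ (λ n → ℚ.- seq x n) λ ε 0<ε → let N , h = cauchy x ε 0<ε in
  N , λ m n Nm Nn → subst (ℚ._< ε)
    (trans (sym (ℚ.∣-p∣≡∣p∣ (seq x m ℚ.- seq x n)))
           (cong ℚ.∣_∣ (ℚ.neg-distrib-+ (seq x m) (ℚ.- seq x n))))
    (h m n Nm Nn)

_-_ : ℝ → ℝ → ℝ
x - y = x + (- y)

private
  bounded : ∀ x → ∃[ B ] 0ℚ ℚ.< B × ∃[ N ] ∀ n → N ℕ.≤ n → ℚ.∣ seq x n ∣ ℚ.≤ B
  bounded x with cauchy x 1ℚ (ℚ.positive⁻¹ 1ℚ)
  ... | N , h = ℚ.∣ seq x N ∣ ℚ.+ 1ℚ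
              , ℚ.+-mono-≤-< (ℚ.0≤∣p∣ (seq x N)) (ℚ.positive⁻¹ 1ℚ)
              , N , λ n Nn → begin
    ℚ.∣ seq x n ∣
      ≡⟨ cong ℚ.∣_∣ (split (seq x n) (seq x N)) ⟩
    ℚ.∣ seq x N ℚ.+ (seq x n ℚ.- seq x N) ∣
      ≤⟨ ℚ.∣p+q∣≤∣p∣+∣q∣ (seq x N) (seq x n ℚ.- seq x N) ⟩
    ℚ.∣ seq x N ∣ ℚ.+ ℚ.∣ seq x n ℚ.- seq x N ∣
      ≤⟨ ℚ.+-monoʳ-≤ ℚ.∣ seq x N ∣ (ℚ.<⇒≤ (h n N Nn ℕ.≤-refl)) ⟩
    ℚ.∣ seq x N ∣ ℚ.+ 1ℚ ∎
    where
    open ℚ.≤-Reasoning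
    split : ∀ a b → a ≡ b ℚ.+ (a ℚ.- b)
    split = solve 2 (λ a b → a := b :+ (a :- b)) refl
      where open +-*-Solver

_*_ : ℝ → ℝ → ℝ
x * y = mkℝ (λ n → seq x n ℚ.* seq y n) c
  where
  c : IsCauchy (λ n → seq x n ℚ.* seq y n)
  c ε 0<ε = go (bounded x) (bounded y)
    where
    go : ∃[ B ] 0ℚ ℚ.< B × (∃[ N ] ∀ n → N ℕ.≤ n → ℚ.∣ seq x n ∣ ℚ.≤ B) →
         ∃[ B ] 0ℚ ℚ.< B × (∃[ N ] ∀ n → N ℕ.≤ n → ℚ.∣ seq y n ∣ ℚ.≤ B) →
         ∃[ N ] ∀ m n → N ℕ.≤ m → N ℕ.≤ n →
           ℚ.∣ seq x m ℚ.* seq y m ℚ.- seq x n ℚ.* seq y n ∣ ℚ.< ε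
    go (Bx , 0<Bx , Nx , hx) (By , 0<By , Ny , hy) =
      N , λ m n Nm Nn → bound (seq x m) (seq x n) (seq y m) (seq y n)
        (cx m n (ℕ.≤-trans l₁ Nm) (ℕ.≤-trans l₁ Nn))
        (cy m n (ℕ.≤-trans l₂ Nm) (ℕ.≤-trans l₂ Nn))
        (hx n (ℕ.≤-trans l₃ Nn)) (hy m (ℕ.≤-trans l₄ Nm))
      where
      instance
        _ = ℚ.>-nonZero 0<Bx
        _ = ℚ.>-nonZero 0<By
      δx = ½ ℚ.* ε ℚ.* ℚ.1/ By
      δy = ½ ℚ.* ε ℚ.* ℚ.1/ Bx
      cδx = cauchy x δx (pos* (pos* 0<½ 0<ε) (inv-pos 0<By))
      cδy = cauchy y δy (pos* (pos* 0<½ 0<ε) (inv-pos 0<Bx))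
      cx = proj₂ cδx
      cy = proj₂ cδy
      N = (proj₁ cδx ℕ.⊔ proj₁ cδy) ℕ.⊔ (Nx ℕ.⊔ Ny)
      l₁ : proj₁ cδx ℕ.≤ N
      l₁ = ℕ.≤-trans (ℕ.m≤m⊔n _ _) (ℕ.m≤m⊔n _ (Nx ℕ.⊔ Ny))
      l₂ : proj₁ cδy ℕ.≤ N
      l₂ = ℕ.≤-trans (ℕ.m≤n⊔m (proj₁ cδx) _) (ℕ.m≤m⊔n _ (Nx ℕ.⊔ Ny))
      l₃ : Nx ℕ.≤ N
      l₃ = ℕ.≤-trans (ℕ.m≤m⊔n Nx Ny) (ℕ.m≤n⊔m (proj₁ cδx ℕ.⊔ proj₁ cδy) _)
      l₄ : Ny ℕ.≤ N
      l₄ = ℕ.≤-trans (ℕ.m≤n⊔m Nx Ny) (ℕ.m≤n⊔m (proj₁ cδx ℕ.⊔ proj₁ cδy) _)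

      rearrange : ∀ a b c d → a ℚ.* c ℚ.- b ℚ.* d ≡ (a ℚ.- b) ℚ.* c ℚ.+ (c ℚ.- d) ℚ.* b
      rearrange = solve 4 (λ a b c d → a :* c :- b :* d := (a :- b) :* c :+ (c :- d) :* b) refl
        where open +-*-Solver

      cancel : ∀ B .{{_ : ℚ.NonZero B}} → ½ ℚ.* ε ℚ.* ℚ.1/ B ℚ.* B ≡ ½ ℚ.* ε
      cancel B = trans (ℚ.*-assoc (½ ℚ.* ε) (ℚ.1/ B) B)
        (trans (cong ((½ ℚ.* ε) ℚ.*_) (ℚ.*-inverseˡ B)) (ℚ.*-identityʳ (½ ℚ.* ε)))

      part : ∀ {d c δ B} → 0ℚ ℚ.< B → ℚ.∣ d ∣ ℚ.< δ → ℚ.∣ c ∣ ℚ.≤ B → ℚ.∣ d ℚ.* c ∣ ℚ.< δ ℚ.* B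
      part {d} {c} {δ} {B} 0<B d<δ c≤B = begin-strict
        ℚ.∣ d ℚ.* c ∣         ≡⟨ ℚ.∣p*q∣≡∣p∣*∣q∣ d c ⟩
        ℚ.∣ d ∣ ℚ.* ℚ.∣ c ∣   ≤⟨ ℚ.*-monoˡ-≤-nonNeg ℚ.∣ d ∣ {{ℚ.∣-∣-nonNeg d}} c≤B ⟩
        ℚ.∣ d ∣ ℚ.* B         <⟨ ℚ.*-monoˡ-<-pos B {{ℚ.positive 0<B}} d<δ ⟩
        δ ℚ.* B               ∎
        where open ℚ.≤-Reasoning

      bound : ∀ a b c d → ℚ.∣ a ℚ.- b ∣ ℚ.< δx → ℚ.∣ c ℚ.- d ∣ ℚ.< δy →
              ℚ.∣ b ∣ ℚ.≤ Bx → ℚ.∣ c ∣ ℚ.≤ By → ℚ.∣ a ℚ.* c ℚ.- b ℚ.* d ∣ ℚ.< ε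
      bound a b c d ab cd b≤ c≤ = begin-strict
        ℚ.∣ a ℚ.* c ℚ.- b ℚ.* d ∣
          ≡⟨ cong ℚ.∣_∣ (rearrange a b c d) ⟩
        ℚ.∣ (a ℚ.- b) ℚ.* c ℚ.+ (c ℚ.- d) ℚ.* b ∣
          ≤⟨ ℚ.∣p+q∣≤∣p∣+∣q∣ ((a ℚ.- b) ℚ.* c) ((c ℚ.- d) ℚ.* b) ⟩
        ℚ.∣ (a ℚ.- b) ℚ.* c ∣ ℚ.+ ℚ.∣ (c ℚ.- d) ℚ.* b ∣
          <⟨ ℚ.+-mono-< (part {a ℚ.- b} {c} 0<By ab c≤) (part {c ℚ.- d} {b} 0<Bx cd b≤) ⟩
        δx ℚ.* By ℚ.+ δy ℚ.* Bx
          ≡⟨ cong₂ ℚ._+_ (cancel By) (cancel Bx) ⟩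
        ½ ℚ.* ε ℚ.+ ½ ℚ.* ε
          ≡⟨ half ε ⟩
        ε ∎
        where open ℚ.≤-Reasoning

_^_ : ℝ → ℕ → ℝ
x ^ zero  = 1ℝ
x ^ suc n = x * x ^ n

private
  inv : ℚ → ℚ
  inv p with p ℚ.≟ 0ℚ
  ... | yes _  = 0ℚ
  ... | no p≢0 = (ℚ.1/ p) {{ℚ.≢-nonZero p≢0}}

  inv-inverse : ∀ {p} → 0ℚ ℚ.< p → inv p ℚ.* p ≡ 1ℚ
  inv-inverse {p} 0<p with p ℚ.≟ 0ℚ
  ... | yes p≡0 = ⊥-elim (ℚ.<-irrefl (sym p≡0) 0<p)
  ... | no p≢0  = ℚ.*-inverseˡ p {{ℚ.≢-nonZero p≢0}}

-- The reciprocal is taken termwise; the finitely many terms of x that may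
-- vanish are sent to 0.
recip : (x : ℝ) → 0ℝ < x → ℝ
recip x (δ , 0<δ , N₀ , h₀) = mkℝ (λ n → inv (seq x n)) c
  where
  c : IsCauchy (λ n → inv (seq x n))
  c ε 0<ε with cauchy x (ε ℚ.* (δ ℚ.* δ)) (pos* 0<ε (pos* 0<δ 0<δ))
  ... | N , h = N ℕ.⊔ N₀ , λ m n Nm Nn →
    bound (seq x m) (seq x n)
      (δ≤ m (ℕ.≤-trans (ℕ.m≤n⊔m N N₀) Nm)) (δ≤ n (ℕ.≤-trans (ℕ.m≤n⊔m N N₀) Nn))
      (h n m (ℕ.≤-trans (ℕ.m≤m⊔n N N₀) Nn) (ℕ.≤-trans (ℕ.m≤m⊔n N N₀) Nm))
    where
    δ≤ : ∀ n → N₀ ℕ.≤ n → δ ℚ.≤ seq x n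
    δ≤ n Nn = subst (ℚ._≤ seq x n) (ℚ.+-identityˡ δ) (h₀ n Nn)

    bound : ∀ a b → δ ℚ.≤ a → δ ℚ.≤ b → ℚ.∣ b ℚ.- a ∣ ℚ.< ε ℚ.* (δ ℚ.* δ) →
            ℚ.∣ inv a ℚ.- inv b ∣ ℚ.< ε
    bound a b δ≤a δ≤b lt = ℚ.*-cancelʳ-<-nonNeg (a ℚ.* b) {{ℚ.nonNegative 0≤ab}} (begin-strict
      ℚ.∣ inv a ℚ.- inv b ∣ ℚ.* (a ℚ.* b)
        ≡⟨ cong (ℚ.∣ inv a ℚ.- inv b ∣ ℚ.*_) (sym (ℚ.0≤p⇒∣p∣≡p 0≤ab)) ⟩
      ℚ.∣ inv a ℚ.- inv b ∣ ℚ.* ℚ.∣ a ℚ.* b ∣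
        ≡⟨ sym (ℚ.∣p*q∣≡∣p∣*∣q∣ (inv a ℚ.- inv b) (a ℚ.* b)) ⟩
      ℚ.∣ (inv a ℚ.- inv b) ℚ.* (a ℚ.* b) ∣
        ≡⟨ cong ℚ.∣_∣ (trans (rearrange (inv a) (inv b) a b)
             (trans (cong₂ (λ u v → u ℚ.* b ℚ.- v ℚ.* a) (inv-inverse 0<a) (inv-inverse 0<b))
                    (cong₂ ℚ._-_ (ℚ.*-identityˡ b) (ℚ.*-identityˡ a)))) ⟩
      ℚ.∣ b ℚ.- a ∣
        <⟨ lt ⟩
      ε ℚ.* (δ ℚ.* δ)
        ≤⟨ ℚ.*-monoˡ-≤-nonNeg ε {{ℚ.nonNegative (ℚ.<⇒≤ 0<ε)}}
             (*-mono-≤ (ℚ.<⇒≤ 0<δ) (ℚ.<⇒≤ 0<b) δ≤a δ≤b) ⟩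
      ε ℚ.* (a ℚ.* b) ∎)
      where
      open ℚ.≤-Reasoning
      0<a = ℚ.<-≤-trans 0<δ δ≤a
      0<b = ℚ.<-≤-trans 0<δ δ≤b
      0≤ab = ℚ.<⇒≤ (pos* 0<a 0<b)

      rearrange : ∀ u v a b → (u ℚ.- v) ℚ.* (a ℚ.* b) ≡ (u ℚ.* a) ℚ.* b ℚ.- (v ℚ.* b) ℚ.* a
      rearrange = solve 4 (λ u v a b →
        (u :- v) :* (a :* b) := (u :* a) :* b :- (v :* b) :* a) refl
        where open +-*-Solver

-- log₂ n = lim ⌊log₂ (n ^ k)⌋ / k as k → ∞, because
-- 2 ^ ⌊log₂ (n ^ k)⌋ ≤ n ^ k < 2 ^ (1 + ⌊log₂ (n ^ k)⌋) puts the k-th term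
-- within 1 / k of log₂ n.  For n = 0 the value is the junk value 0.
log₂ : ℕ → ℝ
log₂ n = mkℝ (approx n) (c n)
  where
  approx : ℕ → ℕ → ℚ
  approx n k = + ⌊log₂ n ℕ.^ suc k ⌋ ℚ./ suc k

  c : ∀ n → IsCauchy (approx n)
  c zero ε 0<ε = 0 , λ m n _ _ → subst (λ d → ℚ.∣ d ∣ ℚ.< ε)
    (sym (cong₂ ℚ._-_ (ℚ.0/n≡0 (suc m)) (ℚ.0/n≡0 (suc n)))) 0<ε
  c n@(suc _) ε 0<ε with archimedean ε 0<ε
  ... | N , h = N , λ m k Nm Nk → dist< (near m k Nk) (near k m Nm)
    where
    near : ∀ m k → N ℕ.≤ k → approx n m ℚ.< approx n k ℚ.+ ε
    near m k Nk = begin-strict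
      approx n m
        <⟨ /-mono-< ⌊log₂ n ℕ.^ suc m ⌋ (suc ⌊log₂ n ℕ.^ suc k ⌋) m k
             (log-cross n (suc m) (suc k) (ℕ.s≤s ℕ.z≤n) (ℕ.s≤s ℕ.z≤n)) ⟩
      + suc ⌊log₂ n ℕ.^ suc k ⌋ ℚ./ suc k
        ≡⟨ /-suc ⌊log₂ n ℕ.^ suc k ⌋ k ⟩
      approx n k ℚ.+ + 1 ℚ./ suc k
        <⟨ ℚ.+-monoʳ-< (approx n k) (h k Nk) ⟩
      approx n k ℚ.+ ε ∎
      where open ℚ.≤-Reasoning

sumℝ : List ℝ → ℝ
sumℝ = foldr _+_ 0ℝ

TendsTo∞ : (ℕ → ℝ) → Set
TendsTo∞ x = ∀ M → ∃[ N ] ∀ n → N ℕ.≤ n → M < x n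

TendsTo∞ℕ : (ℕ → ℕ) → Set
TendsTo∞ℕ a = ∀ M → ∃[ N ] ∀ n → N ℕ.≤ n → M ℕ.< a n

------------------------------------------------------------------------
-- Families of subsets of X = Fin m

-- A subset of 2^X is given by its characteristic function.
Family : ℕ → Set
Family m = Subset m → Bool

private
  variable
    m : ℕ

⟦_⟧ : Family m → Pred (Subset m) 0ℓ
⟦ F ⟧ S = T (F S)

subsets : ∀ m → List (Subset m)
subsets zero    = [] ∷ []
subsets (suc m) = map (outside ∷_) (subsets m) ++ map (inside ∷_) (subsets m)

members : Family m → List (Subset m)
members F = filterᵇ F (subsets _)

card : Family m → ℕ
card F = length (members F)

IsUpperSet : Family m → Set
IsUpperSet F = ∀ {A B} → A ∈ ⟦ F ⟧ → A Subset.⊆ B → B ∈ ⟦ F ⟧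

Nontrivial : Family m → Set
Nontrivial F = ¬ (⟦ F ⟧ ≐ ∅) × ¬ (⟦ F ⟧ ≐ U)

μ : ℝ → Family m → ℝ
μ {m} p F = sumℝ (map (λ S → p ^ Subset.∣ S ∣ * (1ℝ - p) ^ (m ℕ.∸ Subset.∣ S ∣)) (members F))

InUnitInterval : ℝ → Set
InUnitInterval p = 0ℝ ≤ p × p ≤ 1ℝ

IsCriticalProbability : Family m → ℝ → Set
IsCriticalProbability F p = InUnitInterval p × μ p F ≃ ½ℝ

⟨_⟩ : Family m → Pred (Subset m) 0ℓ
⟨ G ⟩ B = ∃[ S ] S ∈ ⟦ G ⟧ × S Subset.⊆ B

_Covers_ : Family m → Family m → Set
G Covers F = ⟦ F ⟧ ⊆ ⟨ G ⟩

IsSmall : ℝ → Family m → Set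
IsSmall {m} p F = Σ[ G ∈ Family m ]
  G Covers F × sumℝ (map (λ S → p ^ Subset.∣ S ∣) (members G)) ≤ ½ℝ

IsExpectationThreshold : Family m → ℝ → Set
IsExpectationThreshold F q =
  (InUnitInterval q × IsSmall q F) ×
  (∀ p → InUnitInterval p → IsSmall p F → p ≤ q)

IsProperCover : Family m → Family m → Set
IsProperCover F G = G Covers F × ¬ (⟨ G ⟩ ≐ U)

IsCoveringDimension : Family m → ℕ → Set
IsCoveringDimension {m} F d =
  (Σ[ G ∈ Family m ] IsProperCover F G × card G ≡ d) ×
  (∀ G → IsProperCover F G → d ℕ.≤ card G)

Minimal : Family m → Pred (Subset m) 0ℓ
Minimal F S = S ∈ ⟦ F ⟧ × ¬ (∃[ A ] A ∈ ⟦ F ⟧ × A ⊂ S)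

minimal? : (F : Family m) → Decidable (Minimal F)
minimal? F S = T? (F S) ×-dec ¬? (anySubset? λ A → T? (F A) ×-dec (A ⊂? S))

ℓ₀ : Family m → ℕ
ℓ₀ F = max 0 (map Subset.∣_∣ (filter (minimal? F) (subsets _)))

ℓ : Family m → ℕ
ℓ F = ℓ₀ F ℕ.⊔ 2

-- q stands for the sequence of expectation thresholds of F.
KahnKalaiNontrivial : {size : ℕ → ℕ} → ℝ → (ℕ → ℝ) → (∀ n → Family (size n)) → Set
KahnKalaiNontrivial K q F = ∃[ N ] ∀ n → N ℕ.≤ n → K * q n * log₂ (ℓ (F n)) < 1ℝ

-- The expectation threshold controls the covering dimension directly: a proper
-- cover G consists of nonempty sets, so Σ p^|S| ≤ |G| p for p ≤ 1, whence
-- 1 / (2 (1 + dim F)) ≤ q(F).  In particular q(F) > 0.  Nontrivial Kahn-Kalai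
-- bounds K q log ℓ < 1 together with ℓ → ∞ force q → 0, hence 1/q → ∞ and dim → ∞.
module Submission where

open import Defs
open import Data.Bool.Base using (T)
open import Data.Bool.Properties using (T?)
open import Data.Fin.Subset as Subset using (Subset)
open import Data.Fin.Subset.Properties
  using (⊥⊆; nonempty?; Empty-unique; x∈p⇒∣p-x∣<∣p∣)
open import Data.Integer.Base as ℤ using (+_)
import Data.Integer.Properties as ℤ
open import Data.List.Base using (List; []; _∷_; map; length)
open import Data.List.Relation.Unary.All as All using (All; []; _∷_)
open import Data.List.Relation.Unary.All.Properties using (all-filter)
open import Data.Nat using (ℕ; zero; suc)
import Data.Nat as ℕ
open import Data.Nat.Logarithm using (⌊log₂_⌋; ⌊log₂⌋-mono-≤; ⌊log₂[2^n]⌋≡n)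
import Data.Nat.Properties as ℕ
open import Data.Product using (Σ-syntax; ∃-syntax; _×_; _,_; proj₁; proj₂)
open import Data.Rational as ℚ using (ℚ; 0ℚ; 1ℚ; ½)
open import Data.Rational.Literals using (fromℤ)
import Data.Rational.Properties as ℚ
open import Data.Rational.Solver using (module +-*-Solver)
import Data.Rational.Unnormalised as ℚᵘ
import Data.Rational.Unnormalised.Properties as ℚᵘ
open import Function using (_∘_)
open import Relation.Binary.PropositionalEquality
open import Relation.Nullary using (yes; no; contradiction)

-- Natural numbers as rationals, and lower bounds for `log₂`.

fromℕ : ℕ → ℚ
fromℕ n = fromℤ (+ n)

fromℕ-mono-≤ : ∀ {m n} → m ℕ.≤ n → fromℕ m ℚ.≤ fromℕ n
fromℕ-mono-≤ m≤n = ℚ.*≤* (ℤ.*-monoʳ-≤-nonNeg (+ 1) (ℤ.+≤+ m≤n))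

fromℕ-cancel-≤ : ∀ {m n} → fromℕ m ℚ.≤ fromℕ n → m ℕ.≤ n
fromℕ-cancel-≤ (ℚ.*≤* le) = ℤ.drop‿+≤+ (ℤ.*-cancelʳ-≤-pos _ _ (+ 1) le)

fromℕ-suc : ∀ n → fromℕ (suc n) ≡ 1ℚ ℚ.+ fromℕ n
fromℕ-suc n = ℚ.toℚᵘ-injective (ℚᵘ.≃-sym (ℚᵘ.≃-trans (ℚ.toℚᵘ-homo-+ 1ℚ (fromℕ n))
  (ℚᵘ.*≡* (cong (ℤ._* + 1) (cong (ℤ._+_ (+ 1)) (ℤ.*-identityʳ (+ n)))))))

-- A nonnegative rational is at most its numerator, since the denominator is at least 1.
archimedean : ∀ r → ∃[ n ] r ℚ.≤ fromℕ n
archimedean (ℚ.mkℚ (+ n) d _) = n , ℚ.*≤* (ℤ.*-monoˡ-≤-nonNeg (+ n) (ℤ.+≤+ (ℕ.s≤s ℕ.z≤n)))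
archimedean (ℚ.mkℚ ℤ.-[1+ n ] d _) = 0 , ℚ.*≤* ℤ.-≤+

-- The floor logarithm of `(2 ^ L) ^ (k + 1)` is exactly `L * (k + 1)`, so dividing by `k + 1` loses
-- nothing. The bound therefore holds for every approximant, not merely in the limit.
log₂-≥ : ∀ {L n} → 2 ℕ.^ L ℕ.≤ n → ∀ k → fromℕ L ℚ.≤ seq (log₂ n) k
log₂-≥ {L} {n} 2^L≤n k = ℚ.toℚᵘ-cancel-≤ (ℚᵘ.≤-respʳ-≃
  (ℚᵘ.≃-sym (ℚ.toℚᵘ-fromℚᵘ (ℚᵘ.mkℚᵘ (+ a) k)))
  (ℚᵘ.*≤* (subst₂ ℤ._≤_ (ℤ.pos-* L (suc k)) (ℤ.pos-* a 1) (ℤ.+≤+ (begin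
    L ℕ.* suc k                     ≡⟨ ⌊log₂[2^n]⌋≡n (L ℕ.* suc k) ⟨
    ⌊log₂ 2 ℕ.^ (L ℕ.* suc k) ⌋     ≡⟨ cong ⌊log₂_⌋ (ℕ.^-*-assoc 2 L (suc k)) ⟨
    ⌊log₂ (2 ℕ.^ L) ℕ.^ suc k ⌋     ≤⟨ ⌊log₂⌋-mono-≤ (ℕ.^-monoˡ-≤ (suc k) 2^L≤n) ⟩
    a                               ≡⟨ ℕ.*-identityʳ a ⟨
    a ℕ.* 1                         ∎)))))
  where
  open ℕ.≤-Reasoning
  a = ⌊log₂ n ℕ.^ suc k ⌋

0<p*q : ∀ {p q} → 0ℚ ℚ.< p → 0ℚ ℚ.< q → 0ℚ ℚ.< p ℚ.* q
0<p*q {p} {q} 0<p 0<q =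
  ℚ.positive⁻¹ (p ℚ.* q) {{ℚ.pos*pos⇒pos p {{ℚ.positive 0<p}} q {{ℚ.positive 0<q}}}}

-- Properties holding from some index on, and bounds for the terms of a real.

Eventually : (ℕ → Set) → Set
Eventually P = ∃[ N ] ∀ n → N ℕ.≤ n → P n

infixl 4 _⊛_

-- Applicative style: `always step ⊛ h₁ ⊛ h₂` feeds several eventual hypotheses to one pointwise
-- argument.
_⊛_ : ∀ {P Q : ℕ → Set} → Eventually (λ n → P n → Q n) → Eventually P → Eventually Q
(N , f) ⊛ (N′ , p) = N ℕ.⊔ N′ , λ n N≤n →
  f n (ℕ.m⊔n≤o⇒m≤o N N′ N≤n) (p n (ℕ.m⊔n≤o⇒n≤o N N′ N≤n))

always : ∀ {P : ℕ → Set} → (∀ n → P n) → Eventually P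
always p = 0 , λ n _ → p n

eventually-bounded : ∀ x → ∃[ B ] Eventually (λ k → seq x k ℚ.≤ B)
eventually-bounded x with cauchy x 1ℚ (ℚ.positive⁻¹ 1ℚ)
... | N , h = seq x N ℚ.+ 1ℚ , N , λ k N≤k → begin
  seq x k                                    ≡⟨ split (seq x k) (seq x N) ⟩
  seq x N ℚ.+ (seq x k ℚ.- seq x N)          ≤⟨ ℚ.+-monoʳ-≤ (seq x N) (p≤∣p∣ _) ⟩
  seq x N ℚ.+ ℚ.∣ seq x k ℚ.- seq x N ∣      ≤⟨ ℚ.+-monoʳ-≤ (seq x N) (ℚ.<⇒≤ (h k N N≤k ℕ.≤-refl)) ⟩
  seq x N ℚ.+ 1ℚ                             ∎
  where
  open ℚ.≤-Reasoning
  p≤∣p∣ : ∀ p → p ℚ.≤ ℚ.∣ p ∣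
  p≤∣p∣ (ℚ.mkℚ (+ n) _ _)      = ℚ.≤-refl
  p≤∣p∣ (ℚ.mkℚ ℤ.-[1+ n ] _ _) = ℚ.*≤* ℤ.-≤+
  split : ∀ a b → a ≡ b ℚ.+ (a ℚ.- b)
  split = solve 2 (λ a b → a := b :+ (a :- b)) refl
    where open +-*-Solver

-- Positive reals and their reciprocals.

eventually-positive : ∀ {x} → 0ℝ < x → ∃[ δ ] 0ℚ ℚ.< δ × Eventually (λ k → δ ℚ.≤ seq x k)
eventually-positive {x} (δ , 0<δ , N , h) =
  δ , 0<δ , N , λ k N≤k → subst (ℚ._≤ seq x k) (ℚ.+-identityˡ δ) (h k N≤k)

-- `recip` sends vanishing terms to 0, so positivity is asked of the term itself; `0<x` supplies it
-- only for large `k`.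
recip-inverse : ∀ x (0<x : 0ℝ < x) k → 0ℚ ℚ.< seq x k →
                seq (recip x 0<x) k ℚ.* seq x k ≡ 1ℚ
recip-inverse x 0<x k 0<xk with seq x k ℚ.≟ 0ℚ
... | yes xk≡0 = contradiction 0<xk (ℚ.<-irrefl (sym xk≡0))
... | no  xk≢0 = ℚ.*-inverseˡ (seq x k) {{ℚ.≢-nonZero xk≢0}}

-- x ≤ 1/C, with the denominator cleared so that C may be any rational
_≤1/_ : ℝ → ℚ → Set
x ≤1/ C = Eventually (λ k → C ℚ.* seq x k ℚ.≤ 1ℚ)

recip-tendsTo∞ : ∀ (x : ℕ → ℝ) (0<x : ∀ n → 0ℝ < x n) →
                 (∀ C → Eventually (λ n → x n ≤1/ C)) →
                 TendsTo∞ (λ n → recip (x n) (0<x n))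
recip-tendsTo∞ x 0<x x→0 M = always (λ n → bound n) ⊛ x→0 C
  where
  B = proj₁ (eventually-bounded M)
  -- `B` eventually bounds the terms of `M`; the surplus 1 becomes the rational gap that `_<_` on
  -- `ℝ` requires.
  C = B ℚ.+ 1ℚ

  bound : ∀ n → x n ≤1/ C → M < recip (x n) (0<x n)
  bound n x≤1/C with eventually-positive {x n} (0<x n)
  ... | δ , 0<δ , δ≤x = 1ℚ , ℚ.positive⁻¹ 1ℚ ,
    (always step ⊛ proj₂ (eventually-bounded M) ⊛ x≤1/C ⊛ δ≤x)
    where
    step : ∀ k → seq M k ℚ.≤ B → C ℚ.* seq (x n) k ℚ.≤ 1ℚ → δ ℚ.≤ seq (x n) k →
           seq M k ℚ.+ 1ℚ ℚ.≤ seq (recip (x n) (0<x n)) k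
    step k M≤B Cx≤1 δ≤xk = ℚ.≤-trans (ℚ.+-monoˡ-≤ 1ℚ M≤B)
      (ℚ.*-cancelʳ-≤-pos (seq (x n) k) {{ℚ.positive 0<xk}}
        (subst (C ℚ.* seq (x n) k ℚ.≤_) (sym (recip-inverse (x n) (0<x n) k 0<xk)) Cx≤1))
      where
      0<xk = ℚ.<-≤-trans 0<δ δ≤xk

-- Convergence of the thresholds to zero.

threshold→0 : ∀ (K : ℝ) (q : ℕ → ℝ) (l : ℕ → ℕ) → 0ℝ < K → (∀ n → 0ℝ < q n) →
              TendsTo∞ℕ l → Eventually (λ n → K * q n * log₂ (l n) < 1ℝ) →
              ∀ C → Eventually (λ n → q n ≤1/ C)
threshold→0 K q l 0<K 0<q l→∞ informative C with eventually-positive {K} 0<K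
... | κ , 0<κ , κ≤K = always (λ n → bound n) ⊛ l→∞ (2 ℕ.^ L) ⊛ informative
  where
  instance
    _ = ℚ.>-nonZero 0<κ
    _ = ℚ.positive 0<κ
    _ = ℚ.nonNegative (ℚ.<⇒≤ 0<κ)
  -- An integer at least `C / κ`. Once `l n` exceeds `2 ^ L`, the terms satisfy
  -- `C q ≤ κ L q ≤ K q log₂ (l n)`, and the last is eventually below 1.
  L = proj₁ (archimedean (C ℚ.* ℚ.1/ κ))

  C≤κL : C ℚ.≤ κ ℚ.* fromℕ L
  C≤κL = begin
    C                           ≡⟨ ℚ.*-identityʳ C ⟨
    C ℚ.* 1ℚ                    ≡⟨ cong (C ℚ.*_) (ℚ.*-inverseˡ κ) ⟨
    C ℚ.* (ℚ.1/ κ ℚ.* κ)        ≡⟨ ℚ.*-assoc C (ℚ.1/ κ) κ ⟨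
    C ℚ.* ℚ.1/ κ ℚ.* κ          ≡⟨ ℚ.*-comm (C ℚ.* ℚ.1/ κ) κ ⟩
    κ ℚ.* (C ℚ.* ℚ.1/ κ)        ≤⟨ ℚ.*-monoˡ-≤-nonNeg κ (proj₂ (archimedean (C ℚ.* ℚ.1/ κ))) ⟩
    κ ℚ.* fromℕ L               ∎
    where open ℚ.≤-Reasoning

  bound : ∀ n → 2 ℕ.^ L ℕ.< l n → K * q n * log₂ (l n) < 1ℝ → q n ≤1/ C
  bound n 2^L<l (ε , 0<ε , ev) with eventually-positive {q n} (0<q n)
  ... | δ , 0<δ , δ≤q = always step ⊛ κ≤K ⊛ δ≤q ⊛ ev
    where
    step : ∀ k → κ ℚ.≤ seq K k → δ ℚ.≤ seq (q n) k →
           seq K k ℚ.* seq (q n) k ℚ.* seq (log₂ (l n)) k ℚ.+ ε ℚ.≤ 1ℚ →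
           C ℚ.* seq (q n) k ℚ.≤ 1ℚ
    step k κ≤Kk δ≤qk le = begin
      C ℚ.* x                 ≤⟨ ℚ.*-monoʳ-≤-nonNeg x C≤κL ⟩
      κ ℚ.* fromℕ L ℚ.* x     ≡⟨ swap κ (fromℕ L) x ⟩
      κ ℚ.* x ℚ.* fromℕ L     ≤⟨ ℚ.*-monoʳ-≤-nonNeg (fromℕ L) (ℚ.*-monoʳ-≤-nonNeg x κ≤Kk) ⟩
      y ℚ.* x ℚ.* fromℕ L     ≤⟨ ℚ.*-monoˡ-≤-nonNeg (y ℚ.* x) (log₂-≥ (ℕ.<⇒≤ 2^L<l) k) ⟩
      y ℚ.* x ℚ.* λk          ≡⟨ ℚ.+-identityʳ _ ⟨
      y ℚ.* x ℚ.* λk ℚ.+ 0ℚ   ≤⟨ ℚ.+-monoʳ-≤ (y ℚ.* x ℚ.* λk) (ℚ.<⇒≤ 0<ε) ⟩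
      y ℚ.* x ℚ.* λk ℚ.+ ε    ≤⟨ le ⟩
      1ℚ                      ∎
      where
      open ℚ.≤-Reasoning
      x  = seq (q n) k
      y  = seq K k
      λk = seq (log₂ (l n)) k
      0<x = ℚ.<-≤-trans 0<δ δ≤qk
      0<y = ℚ.<-≤-trans 0<κ κ≤Kk
      instance
        _ = ℚ.nonNegative (ℚ.<⇒≤ 0<x)
        _ = ℚ.nonNegative {y ℚ.* x} (ℚ.<⇒≤ (0<p*q 0<y 0<x))
      swap : ∀ a b c → a ℚ.* b ℚ.* c ≡ a ℚ.* c ℚ.* b
      swap = solve 3 (λ a b c → a :* b :* c := a :* c :* b) refl
        where open +-*-Solver

-- Weights of proper covers.

∣S∣≡0⇒S≡⊥ : ∀ {m} {S : Subset m} → Subset.∣ S ∣ ≡ 0 → S ≡ Subset.⊥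
∣S∣≡0⇒S≡⊥ {S = S} ∣S∣≡0 with nonempty? S
... | yes (x , x∈S) = contradiction
  (subst (Subset.∣ S Subset.- x ∣ ℕ.<_) ∣S∣≡0 (x∈p⇒∣p-x∣<∣p∣ x∈S)) ℕ.n≮0
... | no  empty     = Empty-unique empty

-- The empty set lies below every set, so a family containing it generates all of `2^X`.
properCover-nonempty : ∀ {m} {F G : Family m} → IsProperCover F G →
                       All (λ S → Subset.∣ S ∣ ≢ 0) (members G)
properCover-nonempty {m} {G = G} (_ , ⟨G⟩≢U) = All.map
  (λ S∈G ∣S∣≡0 → ⟨G⟩≢U ((λ _ → _) , λ _ →
    Subset.⊥ , subst (T ∘ G) (∣S∣≡0⇒S≡⊥ ∣S∣≡0) S∈G , ⊥⊆))
  (all-filter (T? ∘ G) (subsets m))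

module _ {p : ℚ} (0≤p : 0ℚ ℚ.≤ p) (p≤1 : p ℚ.≤ 1ℚ) where

  private instance
    p-nonNeg : ℚ.NonNegative p
    p-nonNeg = ℚ.nonNegative 0≤p

  ^-≤1 : ∀ n k → seq (fromℚ p ^ n) k ℚ.≤ 1ℚ
  -- Multiplying `p ^ n ≤ 1` by `p` gives this, and `p ≤ 1` turns it into the next case of `^-≤1`;
  -- hence the joint induction.
  ^-suc≤ : ∀ n k → seq (fromℚ p ^ suc n) k ℚ.≤ p

  ^-≤1 zero    k = ℚ.≤-refl
  ^-≤1 (suc n) k = ℚ.≤-trans (^-suc≤ n k) p≤1

  ^-suc≤ n k = subst (seq (fromℚ p ^ suc n) k ℚ.≤_) (ℚ.*-identityʳ p)
    (ℚ.*-monoˡ-≤-nonNeg p (^-≤1 n k))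

  -- Each nonempty set contributes at most `p`. Powers of the constant sequence `fromℚ p` are
  -- computed termwise, so the bound holds at every `k` without an error term.
  sum-≤ : ∀ {m} (Ss : List (Subset m)) → All (λ S → Subset.∣ S ∣ ≢ 0) Ss → ∀ k →
          seq (sumℝ (map (λ S → fromℚ p ^ Subset.∣ S ∣) Ss)) k ℚ.≤ fromℕ (length Ss) ℚ.* p
  sum-≤ []       []         k = ℚ.≤-reflexive (sym (ℚ.*-zeroˡ p))
  sum-≤ (S ∷ Ss) (S≢0 ∷ hs) k =
    ℚ.≤-trans (ℚ.+-mono-≤ (term Subset.∣ S ∣ S≢0) (sum-≤ Ss hs k)) (ℚ.≤-reflexive (sym eq))
    where
    term : ∀ n → n ≢ 0 → seq (fromℚ p ^ n) k ℚ.≤ p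
    term zero    n≢0 = contradiction refl n≢0
    term (suc n) _   = ^-suc≤ n k

    eq : fromℕ (suc (length Ss)) ℚ.* p ≡ p ℚ.+ fromℕ (length Ss) ℚ.* p
    eq = trans (cong (ℚ._* p) (fromℕ-suc (length Ss)))
      (trans (ℚ.*-distribʳ-+ p 1ℚ (fromℕ (length Ss)))
             (cong (ℚ._+ fromℕ (length Ss) ℚ.* p) (ℚ.*-identityˡ p)))

-- Rational test probabilities.

fromℚ-mono-≤ : ∀ {p q} → p ℚ.≤ q → fromℚ p ≤ fromℚ q
fromℚ-mono-≤ {p} {q} p≤q ε 0<ε = always λ _ → subst (ℚ._≤ q ℚ.+ ε) (ℚ.+-identityʳ p)
  (ℚ.+-mono-≤ p≤q (ℚ.<⇒≤ 0<ε))

-- The shift by one keeps the denominator nonzero, even for an empty cover.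
1/[1+_] : ℕ → ℚ
1/[1+ d ] = ℚ.1/ fromℕ (suc d)

0<1/[1+_] : ∀ d → 0ℚ ℚ.< 1/[1+ d ]
0<1/[1+ d ] = ℚ.positive⁻¹ 1/[1+ d ]

fromℕ*1/[1+_]≤1 : ∀ d {n} → n ℕ.≤ suc d → fromℕ n ℚ.* 1/[1+ d ] ℚ.≤ 1ℚ
fromℕ*1/[1+ d ]≤1 n≤ = ℚ.≤-trans
  (ℚ.*-monoʳ-≤-nonNeg 1/[1+ d ] (fromℕ-mono-≤ n≤))
  (ℚ.≤-reflexive (ℚ.*-inverseʳ (fromℕ (suc d))))

fromℕ*1/[1+_]≤1⁻¹ : ∀ d {n} → fromℕ n ℚ.* 1/[1+ d ] ℚ.≤ 1ℚ → n ℕ.≤ suc d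
fromℕ*1/[1+ d ]≤1⁻¹ le = fromℕ-cancel-≤ (ℚ.*-cancelʳ-≤-pos 1/[1+ d ]
  (ℚ.≤-trans le (ℚ.≤-reflexive (sym (ℚ.*-inverseʳ (fromℕ (suc d)))))))

-- The expectation threshold against the size of a proper cover.

module _ {m} {F G : Family m} {q : ℝ} (threshold : IsExpectationThreshold F q)
         (proper : IsProperCover F G) where

  private
    r p : ℚ
    r = 1/[1+ card G ]
    -- Chosen so that the weight of `G`, at most `card G * p`, stays within ½; by maximality `q` is
    -- then at least `p`.
    p = ½ ℚ.* r

    0<p : 0ℚ ℚ.< p
    0<p = 0<p*q (ℚ.positive⁻¹ ½) 0<1/[1+ card G ]

    p≤1 : p ℚ.≤ 1ℚ
    p≤1 = ℚ.≤-trans (ℚ.*-monoˡ-≤-nonNeg ½ (subst (ℚ._≤ 1ℚ) (ℚ.*-identityˡ r)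
      (fromℕ*1/[1+ card G ]≤1 {1} (ℕ.s≤s ℕ.z≤n)))) (ℚ.≤-trans (ℚ.≤-reflexive (ℚ.*-identityʳ ½)) ½≤1)
      where
      ½≤1 : ½ ℚ.≤ 1ℚ
      ½≤1 = ℚ.*≤* (ℤ.+≤+ (ℕ.s≤s ℕ.z≤n))

    small : IsSmall (fromℚ p) F
    small = G , proj₁ proper , λ ε 0<ε → always λ k → begin
      seq (sumℝ (map (λ S → fromℚ p ^ Subset.∣ S ∣) (members G))) k
        ≤⟨ sum-≤ (ℚ.<⇒≤ 0<p) p≤1 (members G) (properCover-nonempty proper) k ⟩
      fromℕ (card G) ℚ.* (½ ℚ.* r)
        ≡⟨ swap (fromℕ (card G)) ½ r ⟩
      ½ ℚ.* (fromℕ (card G) ℚ.* r)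
        ≤⟨ ℚ.*-monoˡ-≤-nonNeg ½ (fromℕ*1/[1+ card G ]≤1 (ℕ.n≤1+n (card G))) ⟩
      ½
        ≤⟨ ℚ.+-monoʳ-≤ ½ (ℚ.<⇒≤ 0<ε) ⟩
      ½ ℚ.+ ε ∎
      where
      open ℚ.≤-Reasoning
      swap : ∀ a b c → a ℚ.* (b ℚ.* c) ≡ b ℚ.* (a ℚ.* c)
      swap = solve 3 (λ a b c → a :* (b :* c) := b :* (a :* c)) refl
        where open +-*-Solver

  -- The second factor ½ absorbs the ε in the definition of _≤_ on ℝ.
  threshold-≥ : Eventually (λ k → ½ ℚ.* (½ ℚ.* 1/[1+ card G ]) ℚ.≤ seq q k)
  threshold-≥ = always (λ k p≤q+½p → ℚ.≤-trans
      (ℚ.≤-reflexive (half p))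
      (subst (p ℚ.- ½ ℚ.* p ℚ.≤_) (cancel (seq q k) (½ ℚ.* p)) (ℚ.+-monoˡ-≤ (ℚ.- (½ ℚ.* p)) p≤q+½p)))
    ⊛ proj₂ threshold (fromℚ p) (fromℚ-mono-≤ (ℚ.<⇒≤ 0<p) , fromℚ-mono-≤ p≤1) small
        (½ ℚ.* p) (0<p*q (ℚ.positive⁻¹ ½) 0<p)
    where
    open +-*-Solver
    half : ∀ a → ½ ℚ.* a ≡ a ℚ.- ½ ℚ.* a
    half = solve 1 (λ a → con ½ :* a := a :- con ½ :* a) refl
    cancel : ∀ a b → a ℚ.+ b ℚ.- b ≡ a
    cancel = solve 2 (λ a b → a :+ b :- b := a) refl

  threshold-positive : 0ℝ < q
  threshold-positive = ½ ℚ.* p , 0<p*q (ℚ.positive⁻¹ ½) 0<p ,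
    (always (λ k → subst (ℚ._≤ seq q k) (sym (ℚ.+-identityˡ (½ ℚ.* p)))) ⊛ threshold-≥)

  -- The factor 4 cancels the two halves in `threshold-≥`, leaving `(2 + M) / (1 + card G) ≤ 1`. Of
  -- the 2 in `2 + M`, one unit offsets the shifted denominator and the other makes the conclusion
  -- strict.
  ≤1/⇒<card : ∀ M → q ≤1/ (fromℕ 4 ℚ.* fromℕ (2 ℕ.+ M)) → M ℕ.< card G
  ≤1/⇒<card M q≤1/C = ℕ.s≤s⁻¹ (fromℕ*1/[1+ card G ]≤1⁻¹ (begin
    N ℚ.* r                                  ≡⟨ regroup N r ⟩
    fromℕ 4 ℚ.* N ℚ.* (½ ℚ.* (½ ℚ.* r))      ≤⟨ ℚ.*-monoˡ-≤-nonNeg (fromℕ 4 ℚ.* N) (proj₂ both k₀ ℕ.≤-refl .proj₁) ⟩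
    fromℕ 4 ℚ.* N ℚ.* seq q k₀               ≤⟨ proj₂ both k₀ ℕ.≤-refl .proj₂ ⟩
    1ℚ                                       ∎))
    where
    open ℚ.≤-Reasoning
    N = fromℕ (2 ℕ.+ M)
    both = always (λ _ → _,_) ⊛ threshold-≥ ⊛ q≤1/C
    -- The resulting inequality is between constants, so a single index where both bounds on `q`
    -- hold suffices.
    k₀ = proj₁ both
    instance
      _ = ℚ.nonNegative {fromℕ 4 ℚ.* N} (ℚ.<⇒≤ (0<p*q (ℚ.positive⁻¹ (fromℕ 4)) (ℚ.positive⁻¹ N)))
    regroup : ∀ a b → a ℚ.* b ≡ fromℕ 4 ℚ.* a ℚ.* (½ ℚ.* (½ ℚ.* b))
    regroup = solve 2 (λ a b → a :* b :=
      con (fromℕ 4) :* a :* (con ½ :* (con ½ :* b))) refl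
      where open +-*-Solver

mainTheorem3 : (size : ℕ → ℕ) (F : ∀ n → Family (size n)) →
    (∀ n → IsUpperSet (F n)) → (∀ n → Nontrivial (F n)) →
    (pc q : ℕ → ℝ) (dim : ℕ → ℕ) →
    (∀ n → IsCriticalProbability (F n) (pc n)) →
    (∀ n → IsExpectationThreshold (F n) (q n)) →
    (∀ n → IsCoveringDimension (F n) (dim n)) →
    (K : ℝ) → 0ℝ < K →
    (∀ n → pc n ≤ K * q n * log₂ (ℓ (F n))) →
    TendsTo∞ℕ (λ n → ℓ (F n)) →
    KahnKalaiNontrivial K q F →
    (Σ[ q>0 ∈ (∀ n → 0ℝ < q n) ] TendsTo∞ (λ n → recip (q n) (q>0 n)))
    × TendsTo∞ℕ dim
mainTheorem3 size F _ _ _ q dim _ threshold dimension K 0<K _ ℓ→∞ informative =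
  (0<q , recip-tendsTo∞ q 0<q q→0) , λ M →
    always (λ n q≤1/C → subst (M ℕ.<_) (card≡dim n) (≤1/⇒<card (threshold n) (proper n) M q≤1/C))
    ⊛ q→0 (fromℕ 4 ℚ.* fromℕ (2 ℕ.+ M))
  where
  -- The cover attaining `dim n` serves twice: its properness gives `0 < q n`, and its cardinality
  -- carries the bound over to `dim n`.
  proper = λ n → proj₁ (proj₂ (proj₁ (dimension n)))
  card≡dim = λ n → proj₂ (proj₂ (proj₁ (dimension n)))

  0<q : ∀ n → 0ℝ < q n
  0<q n = threshold-positive (threshold n) (proper n)

  q→0 = threshold→0 K q (λ n → ℓ (F n)) 0<K 0<q ℓ→∞ informative
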